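{- Let $1\leq k\leq l$ be integers. For every $(k,l)$-free polynomial $f$, its support $\mathrm{sup}(f)$ is a union of at most $2\,\mathrm{C}_{0/1}(f)$ supports $\mathrm{sup}(gh)$ of products $gh$ of polynomials such that $|\mathrm{min}(gh)|\leq kl^2$. In particular, \[ \mathrm{C}_{0/1}(f)\geq \frac{|\mathrm{min}(f)|}{2kl^2}\,. \]
   Context: All polynomials have nonnegative integer coefficients; the monomials of a polynomial are those with nonzero coefficient. The support $\mathrm{sup}(f)$ of a polynomial $f$ is the family of the sets of variables (those occurring with nonzero exponent) of the monomials of $f$. $\mathrm{min}(f)\subseteq\mathrm{sup}(f)$ is the family of all members of $\mathrm{sup}(f)$ that are minimal, i.e. do not contain any other member of $\mathrm{sup}(f)$. A polynomial $f$ is $(k,l)$-free if, for every two polynomials $g$ and $h$, $\mathrm{sup}(gh)\subseteq\mathrm{sup}(f)$ implies $|\mathrm{min}(g)|\leq k$ or $|\mathrm{min}(h)|\leq l$. A $\{+,\times\}$-circuit is a directed acyclic graph whose input nodes (fanin $0$) correspond to variables $x_1,\ldots,x_n$ and whose other nodes, called gates, have fanin two and are labelled $+$ or $\times$; its size is the number of gates. Syntactically (formally, expanding by distributivity) the circuit produces at each node a polynomial: $x_i$ at an input $x_i$, and the sum (product) of the polynomials produced at its two inputs at a $+$ ($\times$) gate. The polynomial $F$ produced by the circuit is the one produced at its output gate. The circuit counts $f(x_1,\dots,x_n)$ if $F(a)=f(a)$ for all $a\in\{0,1\}^n$. $\mathrm{C}_{0/1}(f)$ denotes the minimum size of a $\{+,\times\}$-circuit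 counting $f$. -}

module Defs where

open import Data.Bool.Properties as Bool using ()
open import Data.Fin using (Fin; zero; suc; toℕ)
open import Data.Fin.Subset using (Subset; Side; inside; outside; _⊆_)
open import Data.Fin.Subset.Properties using (_⊆?_)
open import Data.List using (List; []; _∷_; _++_; map; filter; deduplicate; cartesianProductWith; length)
open import Data.List.Membership.Propositional using (_∈_)
open import Data.List.Relation.Unary.All using (All; all?)
open import Data.Nat using (ℕ; zero; suc; _+_; _*_; _^_; _≤_; NonZero; >-nonZero; _≟_)
open import Data.Nat.ListAction using (sum)
open import Data.Nat.Properties using (≤-trans; m*n≢0; m^n≢0)
open import Data.Product using (_×_; _,_; proj₁; proj₂; ∃-syntax)
open import Data.Sum using (_⊎_; inj₁; inj₂)
open import Data.Vec as Vec using (Vec)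
open import Data.Vec.Properties as Vec using ()
open import Relation.Binary.Definitions using (DecidableEquality)
open import Relation.Binary.PropositionalEquality using (_≡_)
open import Relation.Nullary using (¬?; _→-dec_)
open import Relation.Unary using (Decidable)

private
  variable
    n s : ℕ

------------------------------------------------------------------------
-- Polynomials in n variables with coefficients in ℕ

Exponents : ℕ → Set
Exponents n = Vec ℕ n

_≟ₑ_ : DecidableEquality (Exponents n)
_≟ₑ_ = Vec.≡-dec _≟_

-- A polynomial is a formal sum of terms (coefficient , exponents).  The
-- same exponent vector may be listed several times, and listed coefficients
-- may be 0; only the total coefficient given by `coeff` is meaningful.
Poly : ℕ → Set
Poly n = List (ℕ × Exponents n)

coeff : Poly n → Exponents n → ℕ
coeff f e = sum (map proj₁ (filter (λ t → proj₂ t ≟ₑ e) f))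

monomials : Poly n → List (Exponents n)
monomials f = deduplicate _≟ₑ_ (filter (λ e → ¬? (coeff f e ≟ 0)) (map proj₂ f))

var : Fin n → Poly n
var i = (1 , Vec.replicate _ 0 Vec.[ i ]≔ 1) ∷ []

infixl 6 _+ₚ_
infixl 7 _*ₚ_

_+ₚ_ : Poly n → Poly n → Poly n
_+ₚ_ = _++_

_*ₜ_ : ℕ × Exponents n → ℕ × Exponents n → ℕ × Exponents n
(c , d) *ₜ (c′ , d′) = c * c′ , Vec.zipWith _+_ d d′

_*ₚ_ : Poly n → Poly n → Poly n
_*ₚ_ = cartesianProductWith _*ₜ_

evalMonomial : Exponents n → Vec ℕ n → ℕ
evalMonomial e a = Vec.foldr′ _*_ 1 (Vec.zipWith _^_ a e)

eval : Poly n → Vec ℕ n → ℕ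
eval f a = sum (map (λ t → proj₁ t * evalMonomial (proj₂ t) a) f)

------------------------------------------------------------------------
-- Supports.  A finite family of sets of variables is a list of subsets;
-- the lists `sup f` and `min f` have no repetitions, so that `length` is
-- the cardinality of the family.

Family : ℕ → Set
Family n = List (Subset n)

_≟ₛ_ : DecidableEquality (Subset n)
_≟ₛ_ = Vec.≡-dec Bool._≟_

occurs : ℕ → Side
occurs zero    = outside
occurs (suc _) = inside

vars : Exponents n → Subset n
vars = Vec.map occurs

sup : Poly n → Family n
sup f = deduplicate _≟ₛ_ (map vars (monomials f))

Minimal : Family n → Subset n → Set
Minimal 𝓕 S = All (λ T → T ⊆ S → T ≡ S) 𝓕

minimal? : (𝓕 : Family n) → Decidable (Minimal 𝓕)
minimal? 𝓕 S = all? (λ T → (T ⊆? S) →-dec (T ≟ₛ S)) 𝓕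

min : Poly n → Family n
min f = filter (minimal? (sup f)) (sup f)

Free : ℕ → ℕ → Poly n → Set
Free {n} k l f =
  (g h : Poly n) → (∀ {S} → S ∈ sup (g *ₚ h) → S ∈ sup f) →
  length (min g) ≤ k ⊎ length (min h) ≤ l

------------------------------------------------------------------------
-- {+,×}-circuits

-- The fanin-2 nodes of the acyclic graph are listed in a topological order:
-- `Gates n s` is a list of s gates, each reading from input nodes and from
-- gates listed earlier.  Index `zero` refers to the most recently added gate.
-- The two inputs of a gate may coincide.

Node : ℕ → ℕ → Set
Node n s = Fin n ⊎ Fin s

data Gate (n s : ℕ) : Set where
  _⊕_ _⊗_ : Node n s → Node n s → Gate n s

infixl 5 _▷_

data Gates (n : ℕ) : ℕ → Set where
  []  : Gates n 0
  _▷_ : Gates n s → Gate n s → Gates n (suc s)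

polyAt   : Gates n s → Node n s → Poly n
gatePoly : Gates n s → Gate n s → Poly n

polyAt G       (inj₁ i)       = var i
polyAt (G ▷ γ) (inj₂ zero)    = gatePoly G γ
polyAt (G ▷ γ) (inj₂ (suc j)) = polyAt G (inj₂ j)

gatePoly G (u ⊕ v) = polyAt G u +ₚ polyAt G v
gatePoly G (u ⊗ v) = polyAt G u *ₚ polyAt G v

-- The output is a gate, never an input node, so every circuit has size ≥ 1.
record Circuit (n : ℕ) : Set where
  field
    size   : ℕ
    gates  : Gates n size
    output : Fin size

open Circuit public

produced : Circuit n → Poly n
produced C = polyAt (gates C) (inj₂ (output C))

Counts : Circuit n → Poly n → Set
Counts {n} C f = (a : Vec (Fin 2) n) →
  eval (produced C) (Vec.map toℕ a) ≡ eval f (Vec.map toℕ a)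

-- `IsC₀₁ f c` says that c is the minimum size of a circuit counting f.  It is
-- a relation since some polynomials (such as 0 and 1) are counted by no circuit.
record IsC₀₁ (f : Poly n) (c : ℕ) : Set where
  field
    attained : ∃[ C ] Counts C f × size C ≡ c
    least    : (C : Circuit n) → Counts C f → c ≤ size C

------------------------------------------------------------------------

2kl²≢0 : ∀ {k l} → 1 ≤ k → k ≤ l → NonZero (2 * (k * l ^ 2))
2kl²≢0 {k} {l} 1≤k k≤l = m*n≢0 2 (k * l ^ 2) {{_}} {{m*n≢0 k (l ^ 2) {{>-nonZero 1≤k}}
  {{m^n≢0 l 2 {{>-nonZero (≤-trans 1≤k k≤l)}}}}}}

{-# OPTIONS --safe #-}

-- Counting on 0/1 inputs determines the support, so the circuit produces some
-- F with sup F = sup f.  Walk from the output gate down the circuit while the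
-- polynomial g at the current node is large (|min g| > l).  The part of F
-- formed through that node is g times a weight h, the product of the siblings
-- met on the way, and freeness forces |min h| ≤ k.  The walk stops at an
-- addition gate with a small child, contributing a product with at most l · k
-- minimal sets, or at a multiplication gate with two small children,
-- contributing one with at most l · l · k.  Each gate is charged at most twice.

module Submission where

open import Defs
open import Data.Bool using (_∨_)
open import Data.Fin using (Fin; zero; suc; toℕ) renaming (_≟_ to _≟ᶠ_)
open import Data.Fin.Properties using (toℕ<n)
open import Data.Nat hiding (_/_; _≥_)
open import Data.Nat.Properties
open import Data.Integer as ℤ using (+_; +≤+)
import Data.Integer.Properties as ℤ
open import Data.Rational.Unnormalised using (_/_; _≥_; *≤*)
open import Data.Fin.Subset using (Subset; inside; outside; ⊥; _∪_; _⊆_; _⊂_)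
open import Data.Fin.Subset.Induction using (Acc; acc; ⊂-wellFounded)
open import Data.Fin.Subset.Properties
  using (_∈?_; _⊂?_; ⊆-refl; ⊆-trans; ⊆-antisym; x∈p∪q⁺; x∈p∪q⁻; ∪-assoc; ∪-comm; ∪-identityʳ)
open import Data.List using (List; []; _∷_; _++_; length; map; filter; deduplicate; concatMap; cartesianProductWith)
open import Data.List.Properties using (length-++; length-map; length-filter; length-deduplicate; filter-notAll)
open import Data.List.Membership.Propositional using (_∈_; find; lose)
open import Data.List.Membership.Propositional.Properties
  using (∈-map⁺; ∈-map⁻; ∈-filter⁺; ∈-filter⁻; ∈-deduplicate⁺; ∈-deduplicate⁻;
         ∈-cartesianProductWith⁺; ∈-cartesianProductWith⁻; ∈-concatMap⁺)
open import Data.List.Relation.Unary.All as All using (All; []; _∷_)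
import Data.List.Relation.Unary.All.Properties as All
open import Data.List.Relation.Unary.Any as Any using (Any; here; there)
import Data.List.Relation.Unary.Any.Properties as Any
open import Data.List.Relation.Unary.AllPairs using ([]; _∷_)
open import Data.List.Relation.Unary.Unique.Propositional using (Unique)
open import Data.List.Relation.Unary.Unique.DecPropositional.Properties using (deduplicate-!)
open import Data.List.Relation.Unary.Unique.Propositional.Properties using (filter⁺)
open import Data.Nat.ListAction using (sum)
open import Data.Product using (_×_; _,_; proj₁; proj₂; Σ-syntax; ∃-syntax; ∃₂)
open import Data.Sum as Sum using (_⊎_; inj₁; inj₂; [_,_]′)
open import Data.Vec as Vec using (Vec; []; _∷_)
open import Data.Vec.Properties using (∷-injectiveʳ)
open import Function using (_∘_; id)
open import Function.Bundles using (_⇔_; mk⇔)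
open import Relation.Binary.Definitions using (DecidableEquality)
open import Relation.Binary.PropositionalEquality
open import Relation.Nullary using (¬_; yes; no; ¬?; contradiction; decidable-stable)

private
  variable
    n s : ℕ

-- Cardinalities of lists

module _ {A : Set} (_≟_ : DecidableEquality A) where

  -- Induction on `xs`: deleting the head from `ys` makes it strictly shorter, and by uniqueness the
  -- tail survives the deletion.
  unique-⊆⇒length-≤ : {xs ys : List A} → Unique xs →
    (∀ {x} → x ∈ xs → x ∈ ys) → length xs ≤ length ys
  unique-⊆⇒length-≤ [] _ = z≤n
  unique-⊆⇒length-≤ {x ∷ xs} {ys} (x∉xs ∷ xs!) xs⊆ys = ≤-trans
    (s≤s (unique-⊆⇒length-≤ xs! λ y∈xs →
      ∈-filter⁺ (λ y → ¬? (x ≟ y)) (xs⊆ys (there y∈xs)) (All.lookup x∉xs y∈xs)))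
    (filter-notAll (λ y → ¬? (x ≟ y)) ys (Any.map (λ x≡y x≢y → x≢y x≡y) (xs⊆ys (here refl))))

length-cartesianProductWith : {A B C : Set} (f : A → B → C) (xs : List A) (ys : List B) →
  length (cartesianProductWith f xs ys) ≡ length xs * length ys
length-cartesianProductWith f []       ys = refl
length-cartesianProductWith f (x ∷ xs) ys = trans (length-++ (map (f x) ys))
  (cong₂ _+_ (length-map (f x) ys) (length-cartesianProductWith f xs ys))

length-concatMap-≤ : {A B : Set} (f : A → List B) {b : ℕ} {xs : List A} →
  All (λ x → length (f x) ≤ b) xs → length (concatMap f xs) ≤ length xs * b
length-concatMap-≤ f []                      = z≤n
length-concatMap-≤ f {xs = x ∷ _} (fx≤ ∷ fxs≤) = ≤-trans (≤-reflexive (length-++ (f x)))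
  (+-mono-≤ fx≤ (length-concatMap-≤ f fxs≤))

sum≢0⁺ : ∀ {xs} → Any (_≢ 0) xs → sum xs ≢ 0
sum≢0⁺ {x ∷ _} (here x≢0)  = x≢0 ∘ m+n≡0⇒m≡0 x
sum≢0⁺ {x ∷ _} (there any) = sum≢0⁺ any ∘ m+n≡0⇒n≡0 x

sum≢0⁻ : ∀ xs → sum xs ≢ 0 → Any (_≢ 0) xs
sum≢0⁻ []           0≢0   = contradiction refl 0≢0
sum≢0⁻ (zero ∷ xs)  sum≢0 = there (sum≢0⁻ xs sum≢0)
sum≢0⁻ (suc _ ∷ _)  _     = here λ ()

-- Supports

-- Coefficients in ℕ cannot cancel, so membership in `sup` is witnessed by a single listed term.
-- This form avoids collecting equal exponent vectors.
Supports : Subset n → Poly n → Set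
Supports S = Any (λ t → proj₁ t ≢ 0 × vars (proj₂ t) ≡ S)

sup⁻ : (f : Poly n) {S : Subset n} → S ∈ sup f → Supports S f
sup⁻ f S∈sup
  with e , e∈ , refl ← ∈-map⁻ vars (∈-deduplicate⁻ _≟ₛ_ (map vars (monomials f)) S∈sup)
  with _ , coeff≢0 ← ∈-filter⁻ (λ e → ¬? (coeff f e ≟ 0)) {xs = map proj₂ f} (∈-deduplicate⁻ _≟ₑ_ _ e∈)
  with t , t∈ , c≢0 ← find (Any.map⁻ (sum≢0⁻ _ coeff≢0))
  with t∈f , refl ← ∈-filter⁻ (λ t → proj₂ t ≟ₑ e) {xs = f} t∈
  = lose t∈f (c≢0 , refl)

sup⁺ : (f : Poly n) {S : Subset n} → Supports S f → S ∈ sup f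
sup⁺ f supp with (c , e) , t∈f , c≢0 , refl ← find supp =
  ∈-deduplicate⁺ _≟ₛ_ (∈-map⁺ vars (∈-deduplicate⁺ _≟ₑ_
    (∈-filter⁺ (λ e → ¬? (coeff f e ≟ 0)) (∈-map⁺ proj₂ t∈f)
      (sum≢0⁺ (Any.map⁺ (lose (∈-filter⁺ (λ t → proj₂ t ≟ₑ e) t∈f refl) c≢0))))))

infix 4 _⊑_

-- Only supports matter from here on, so the semiring laws are proved as inclusions of supports, not
-- as equalities of polynomials.
_⊑_ : Poly n → Poly n → Set
f ⊑ g = ∀ {S} → S ∈ sup f → S ∈ sup g

∈-sup-+⁺ˡ : (f g : Poly n) → f ⊑ f +ₚ g
∈-sup-+⁺ˡ f g = sup⁺ (f +ₚ g) ∘ Any.++⁺ˡ ∘ sup⁻ f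

∈-sup-+⁺ʳ : (f g : Poly n) → g ⊑ f +ₚ g
∈-sup-+⁺ʳ f g = sup⁺ (f +ₚ g) ∘ Any.++⁺ʳ f ∘ sup⁻ g

∈-sup-+⁻ : (f g : Poly n) {S : Subset n} → S ∈ sup (f +ₚ g) → S ∈ sup f ⊎ S ∈ sup g
∈-sup-+⁻ f g = Sum.map (sup⁺ f) (sup⁺ g) ∘ Any.++⁻ f ∘ sup⁻ (f +ₚ g)

vars-+ : (d e : Exponents n) → vars (Vec.zipWith _+_ d e) ≡ vars d ∪ vars e
vars-+ []       []       = refl
vars-+ (x ∷ d)  (y ∷ e)  = cong₂ _∷_ (occurs-+ x y) (vars-+ d e)
  where
  occurs-+ : ∀ x y → occurs (x + y) ≡ occurs x ∨ occurs y
  occurs-+ zero    y = refl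
  occurs-+ (suc _) y = refl

-- ℕ has no zero divisors, so two nonzero terms multiply to a nonzero term, which nothing can
-- cancel.
∈-sup-*⁺ : (f g : Poly n) {S T : Subset n} → S ∈ sup f → T ∈ sup g → S ∪ T ∈ sup (f *ₚ g)
∈-sup-*⁺ f g S∈f T∈g
  with (c , d) , t∈f , c≢0 , refl ← find (sup⁻ f S∈f)
  with (c′ , e) , t′∈g , c′≢0 , refl ← find (sup⁻ g T∈g)
  = sup⁺ (f *ₚ g) (lose (∈-cartesianProductWith⁺ _*ₜ_ t∈f t′∈g)
      ([ c≢0 , c′≢0 ]′ ∘ m*n≡0⇒m≡0∨n≡0 c , vars-+ d e))

∈-sup-*⁻ : (f g : Poly n) {S : Subset n} → S ∈ sup (f *ₚ g) →
  ∃₂ λ A B → A ∈ sup f × B ∈ sup g × S ≡ A ∪ B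
∈-sup-*⁻ f g S∈fg
  with _ , t∈fg , cc′≢0 , refl ← find (sup⁻ (f *ₚ g) S∈fg)
  with (c , d) , (c′ , e) , t∈f , t′∈g , refl ← ∈-cartesianProductWith⁻ _*ₜ_ f g t∈fg
  = vars d , vars e
  , sup⁺ f (lose t∈f ((λ { refl → cc′≢0 refl }) , refl))
  , sup⁺ g (lose t′∈g ((λ { refl → cc′≢0 (*-zeroʳ c) }) , refl))
  , vars-+ d e

*-comm-⊑ : (f g : Poly n) → f *ₚ g ⊑ g *ₚ f
*-comm-⊑ f g S∈ with A , B , A∈f , B∈g , refl ← ∈-sup-*⁻ f g S∈ =
  subst (_∈ sup (g *ₚ f)) (∪-comm B A) (∈-sup-*⁺ g f B∈g A∈f)

*-assoc-⊑ : (f g h : Poly n) → f *ₚ g *ₚ h ⊑ f *ₚ (g *ₚ h)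
*-assoc-⊑ f g h S∈
  with _ , C , AB∈ , C∈h , refl ← ∈-sup-*⁻ (f *ₚ g) h S∈
  with A , B , A∈f , B∈g , refl ← ∈-sup-*⁻ f g AB∈
  = subst (_∈ sup (f *ₚ (g *ₚ h))) (sym (∪-assoc A B C))
      (∈-sup-*⁺ f (g *ₚ h) A∈f (∈-sup-*⁺ g h B∈g C∈h))

*-assoc-⊒ : (f g h : Poly n) → f *ₚ (g *ₚ h) ⊑ f *ₚ g *ₚ h
*-assoc-⊒ f g h S∈
  with A , _ , A∈f , BC∈ , refl ← ∈-sup-*⁻ f (g *ₚ h) S∈
  with B , C , B∈g , C∈h , refl ← ∈-sup-*⁻ g h BC∈
  = subst (_∈ sup (f *ₚ g *ₚ h)) (∪-assoc A B C)
      (∈-sup-*⁺ (f *ₚ g) h (∈-sup-*⁺ f g A∈f B∈g) C∈h)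

*-monoˡ-⊑ : (f g h : Poly n) → f ⊑ g → f *ₚ h ⊑ g *ₚ h
*-monoˡ-⊑ f g h f⊑g S∈ with _ , _ , A∈f , B∈h , refl ← ∈-sup-*⁻ f h S∈ =
  ∈-sup-*⁺ g h (f⊑g A∈f) B∈h

*-monoʳ-⊑ : (f g h : Poly n) → g ⊑ h → f *ₚ g ⊑ f *ₚ h
*-monoʳ-⊑ f g h g⊑h S∈ with _ , _ , A∈f , B∈g , refl ← ∈-sup-*⁻ f g S∈ =
  ∈-sup-*⁺ f h A∈f (g⊑h B∈g)

*-distribʳ-⊑ : (f g h : Poly n) {S : Subset n} → S ∈ sup ((f +ₚ g) *ₚ h) →
  S ∈ sup (f *ₚ h) ⊎ S ∈ sup (g *ₚ h)
*-distribʳ-⊑ f g h S∈ with _ , _ , A∈ , B∈h , refl ← ∈-sup-*⁻ (f +ₚ g) h S∈ =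
  Sum.map (λ A∈f → ∈-sup-*⁺ f h A∈f B∈h) (λ A∈g → ∈-sup-*⁺ g h A∈g B∈h) (∈-sup-+⁻ f g A∈)

*-distribˡ-⊑ : (f g h : Poly n) {S : Subset n} → S ∈ sup (f *ₚ (g +ₚ h)) →
  S ∈ sup (f *ₚ g) ⊎ S ∈ sup (f *ₚ h)
*-distribˡ-⊑ f g h S∈ with _ , _ , A∈f , B∈ , refl ← ∈-sup-*⁻ f (g +ₚ h) S∈ =
  Sum.map (∈-sup-*⁺ f g A∈f) (∈-sup-*⁺ f h A∈f) (∈-sup-+⁻ g h B∈)

0ₚ 1ₚ : Poly n
0ₚ = []
1ₚ = (1 , Vec.replicate _ 0) ∷ []

*-zeroʳ-∉ : (f : Poly n) {S : Subset n} → ¬ S ∈ sup (f *ₚ 0ₚ)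
*-zeroʳ-∉ f S∈ with _ , _ , _ , () , _ ← ∈-sup-*⁻ f 0ₚ S∈

vars-0 : ∀ n → vars (Vec.replicate n 0) ≡ ⊥
vars-0 zero    = refl
vars-0 (suc n) = cong (outside ∷_) (vars-0 n)

*-identityʳ-⊒ : (f : Poly n) → f ⊑ f *ₚ 1ₚ
*-identityʳ-⊒ f {S} S∈ = subst (_∈ sup (f *ₚ 1ₚ)) (∪-identityʳ S)
  (∈-sup-*⁺ f 1ₚ S∈ (sup⁺ 1ₚ (here ((λ ()) , vars-0 _))))

*-identityʳ-⊑ : (f : Poly n) → f *ₚ 1ₚ ⊑ f
*-identityʳ-⊑ f S∈ with A , _ , A∈f , B∈1 , refl ← ∈-sup-*⁻ f 1ₚ S∈
  with here (_ , refl) ← sup⁻ 1ₚ B∈1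
  = subst (_∈ sup f) (sym (trans (cong (A ∪_) (vars-0 _)) (∪-identityʳ A))) A∈f

-- Minimal sets

∈-min⁻ : (f : Poly n) {S : Subset n} → S ∈ min f → S ∈ sup f × Minimal (sup f) S
∈-min⁻ f = ∈-filter⁻ (minimal? (sup f)) {xs = sup f}

∈-min⁺ : (f : Poly n) {S : Subset n} → S ∈ sup f → Minimal (sup f) S → S ∈ min f
∈-min⁺ f = ∈-filter⁺ (minimal? (sup f))

min! : (f : Poly n) → Unique (min f)
min! f = filter⁺ (minimal? (sup f)) (deduplicate-! _≟ₛ_ (map vars (monomials f)))

-- Serves for the one-term lists `var i` and `1ₚ`, which thus have at most one minimal set.
length-min-≤ : (f : Poly n) → length (min f) ≤ length f
length-min-≤ f = begin
  length (min f)                          ≤⟨ length-filter (minimal? (sup f)) (sup f) ⟩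
  length (sup f)                          ≤⟨ length-deduplicate _≟ₛ_ (map vars (monomials f)) ⟩
  length (map vars (monomials f))         ≡⟨ length-map vars (monomials f) ⟩
  length (monomials f)                    ≤⟨ length-deduplicate _≟ₑ_ (filter nonzero? (map proj₂ f)) ⟩
  length (filter nonzero? (map proj₂ f))  ≤⟨ length-filter nonzero? (map proj₂ f) ⟩
  length (map proj₂ f)                    ≡⟨ length-map proj₂ f ⟩
  length f                                ∎
  where
  open ≤-Reasoning
  nonzero? = λ e → ¬? (coeff f e ≟ 0)

⊄∧⊆⇒≡ : {S T : Subset n} → ¬ S ⊂ T → S ⊆ T → S ≡ T
⊄∧⊆⇒≡ {S = S} {T} S⊄T S⊆T = ⊆-antisym S⊆T λ {x} x∈T → decidable-stable (x ∈? S)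
  λ x∉S → S⊄T (S⊆T , x , x∈T , x∉S)

-- Passing to a strictly smaller member as long as there is one terminates, since `_⊂_` is well
-- founded.
minimal-below : (𝓕 : Family n) {S : Subset n} → S ∈ 𝓕 →
  ∃[ T ] T ∈ 𝓕 × Minimal 𝓕 T × T ⊆ S
minimal-below 𝓕 {S} = go S (⊂-wellFounded S)
  where
  go : ∀ S → Acc _⊂_ S → S ∈ 𝓕 → ∃[ T ] T ∈ 𝓕 × Minimal 𝓕 T × T ⊆ S
  go S (acc rec) S∈𝓕 with Any.any? (_⊂? S) 𝓕
  ... | no ∄⊂ = S , S∈𝓕 , All.map ⊄∧⊆⇒≡ (All.¬Any⇒All¬ 𝓕 ∄⊂) , ⊆-refl
  ... | yes ∃⊂ with T , T∈𝓕 , T⊂S ← find ∃⊂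
               with U , U∈𝓕 , U-min , U⊆T ← go T (rec T⊂S) T∈𝓕
    = U , U∈𝓕 , U-min , ⊆-trans U⊆T (proj₁ T⊂S)

∪-mono-⊆ : {S S′ T T′ : Subset n} → S ⊆ S′ → T ⊆ T′ → S ∪ T ⊆ S′ ∪ T′
∪-mono-⊆ {S = S} {T = T} S⊆S′ T⊆T′ = x∈p∪q⁺ ∘ Sum.map S⊆S′ T⊆T′ ∘ x∈p∪q⁻ S T

-- A minimal set `A ∪ B` of the product contains `A′ ∪ B′` for some minimal `A′ ⊆ A` and `B′ ⊆ B`,
-- hence equals it. So every minimal set is a union of two minimal ones.
length-min-* : (f g : Poly n) → length (min (f *ₚ g)) ≤ length (min f) * length (min g)
length-min-* f g = begin
  length (min (f *ₚ g))                                ≤⟨ unique-⊆⇒length-≤ _≟ₛ_ (min! (f *ₚ g)) min⊆ ⟩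
  length (cartesianProductWith _∪_ (min f) (min g))    ≡⟨ length-cartesianProductWith _∪_ (min f) (min g) ⟩
  length (min f) * length (min g)                      ∎
  where
  open ≤-Reasoning
  min⊆ : ∀ {S} → S ∈ min (f *ₚ g) → S ∈ cartesianProductWith _∪_ (min f) (min g)
  min⊆ S∈min
    with S∈ , S-min ← ∈-min⁻ (f *ₚ g) S∈min
    with A , B , A∈f , B∈g , refl ← ∈-sup-*⁻ f g S∈
    with A′ , A′∈f , A′-min , A′⊆A ← minimal-below (sup f) A∈f
    with B′ , B′∈g , B′-min , B′⊆B ← minimal-below (sup g) B∈g
    = subst (_∈ cartesianProductWith _∪_ (min f) (min g))
        (All.lookup S-min (∈-sup-*⁺ f g A′∈f B′∈g) (∪-mono-⊆ A′⊆A B′⊆B))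
        (∈-cartesianProductWith⁺ _∪_ (∈-min⁺ f A′∈f A′-min) (∈-min⁺ g B′∈g B′-min))

-- Values on 0/1 inputs determine the support

-- Setting x₁ = 0 keeps the terms of `restrict₀ f`, setting x₁ = 1 keeps all
-- terms; hence the values of `restrict₁ f` are differences of values of f.
restrict₀ restrict₁ : Poly (suc n) → Poly n
restrict₀ []                    = []
restrict₀ ((c , zero  ∷ e) ∷ f) = (c , e) ∷ restrict₀ f
restrict₀ ((c , suc _ ∷ e) ∷ f) = restrict₀ f
restrict₁ []                    = []
restrict₁ ((c , zero  ∷ e) ∷ f) = restrict₁ f
restrict₁ ((c , suc _ ∷ e) ∷ f) = (c , e) ∷ restrict₁ f

eval-0∷ : (f : Poly (suc n)) (a : Vec ℕ n) → eval f (0 ∷ a) ≡ eval (restrict₀ f) a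
eval-0∷ []                    a = refl
eval-0∷ ((c , zero  ∷ e) ∷ f) a = cong₂ _+_ (cong (c *_) (*-identityˡ _)) (eval-0∷ f a)
eval-0∷ ((c , suc _ ∷ e) ∷ f) a = cong₂ _+_ (*-zeroʳ c) (eval-0∷ f a)

eval-1∷ : (f : Poly (suc n)) (a : Vec ℕ n) →
  eval f (1 ∷ a) ≡ eval (restrict₀ f) a + eval (restrict₁ f) a
eval-1∷ []                    a = refl
eval-1∷ ((c , zero  ∷ e) ∷ f) a = trans
  (cong₂ _+_ (cong (c *_) (*-identityˡ _)) (eval-1∷ f a))
  (sym (+-assoc (c * evalMonomial e a) _ _))
eval-1∷ ((c , suc x ∷ e) ∷ f) a = begin
  c * (1 ^ suc x * evalMonomial e a) + eval f (1 ∷ a)  ≡⟨ cong₂ _+_ (cong (λ y → c * (y * evalMonomial e a)) (^-zeroˡ (suc x))) (eval-1∷ f a) ⟩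
  c * (1 * t) + (p + q)                                ≡⟨ cong (λ y → c * y + (p + q)) (*-identityˡ t) ⟩
  c * t + (p + q)                                      ≡⟨ +-assoc (c * t) p q ⟨
  c * t + p + q                                        ≡⟨ cong (_+ q) (+-comm (c * t) p) ⟩
  p + c * t + q                                        ≡⟨ +-assoc p (c * t) q ⟩
  p + (c * t + q)                                      ∎
  where
  open ≡-Reasoning
  t = evalMonomial e a
  p = eval (restrict₀ f) a
  q = eval (restrict₁ f) a

supports-outside⁺ : (f : Poly (suc n)) {S : Subset n} →
  Supports (outside ∷ S) f → Supports S (restrict₀ f)
supports-outside⁺ ((c , zero  ∷ e) ∷ f) (here (c≢0 , eq)) = here (c≢0 , ∷-injectiveʳ eq)
supports-outside⁺ ((c , zero  ∷ e) ∷ f) (there supp)      = there (supports-outside⁺ f supp)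
supports-outside⁺ ((c , suc _ ∷ e) ∷ f) (here (_ , ()))
supports-outside⁺ ((c , suc _ ∷ e) ∷ f) (there supp)      = supports-outside⁺ f supp

supports-outside⁻ : (f : Poly (suc n)) {S : Subset n} →
  Supports S (restrict₀ f) → Supports (outside ∷ S) f
supports-outside⁻ ((c , zero  ∷ e) ∷ f) (here (c≢0 , eq)) = here (c≢0 , cong (outside ∷_) eq)
supports-outside⁻ ((c , zero  ∷ e) ∷ f) (there supp)      = there (supports-outside⁻ f supp)
supports-outside⁻ ((c , suc _ ∷ e) ∷ f) supp              = there (supports-outside⁻ f supp)

supports-inside⁺ : (f : Poly (suc n)) {S : Subset n} →
  Supports (inside ∷ S) f → Supports S (restrict₁ f)
supports-inside⁺ ((c , suc _ ∷ e) ∷ f) (here (c≢0 , eq)) = here (c≢0 , ∷-injectiveʳ eq)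
supports-inside⁺ ((c , suc _ ∷ e) ∷ f) (there supp)      = there (supports-inside⁺ f supp)
supports-inside⁺ ((c , zero  ∷ e) ∷ f) (here (_ , ()))
supports-inside⁺ ((c , zero  ∷ e) ∷ f) (there supp)      = supports-inside⁺ f supp

supports-inside⁻ : (f : Poly (suc n)) {S : Subset n} →
  Supports S (restrict₁ f) → Supports (inside ∷ S) f
supports-inside⁻ ((c , suc _ ∷ e) ∷ f) (here (c≢0 , eq)) = here (c≢0 , cong (inside ∷_) eq)
supports-inside⁻ ((c , suc _ ∷ e) ∷ f) (there supp)      = there (supports-inside⁻ f supp)
supports-inside⁻ ((c , zero  ∷ e) ∷ f) supp              = there (supports-inside⁻ f supp)

infix 4 _≈₀₁_

_≈₀₁_ : Poly n → Poly n → Set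
_≈₀₁_ {n} f g = (a : Vec (Fin 2) n) → eval f (Vec.map toℕ a) ≡ eval g (Vec.map toℕ a)

≈₀₁-restrict₀ : (f g : Poly (suc n)) → f ≈₀₁ g → restrict₀ f ≈₀₁ restrict₀ g
≈₀₁-restrict₀ f g f≈g a = trans (sym (eval-0∷ f _)) (trans (f≈g (zero ∷ a)) (eval-0∷ g _))

≈₀₁-restrict₁ : (f g : Poly (suc n)) → f ≈₀₁ g → restrict₁ f ≈₀₁ restrict₁ g
≈₀₁-restrict₁ f g f≈g a = +-cancelˡ-≡ (eval (restrict₀ f) a′) _ _ (begin
  eval (restrict₀ f) a′ + eval (restrict₁ f) a′  ≡⟨ eval-1∷ f a′ ⟨
  eval f (1 ∷ a′)                                ≡⟨ f≈g (suc zero ∷ a) ⟩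
  eval g (1 ∷ a′)                                ≡⟨ eval-1∷ g a′ ⟩
  eval (restrict₀ g) a′ + eval (restrict₁ g) a′  ≡⟨ cong (_+ eval (restrict₁ g) a′) (≈₀₁-restrict₀ f g f≈g a) ⟨
  eval (restrict₀ f) a′ + eval (restrict₁ g) a′  ∎)
  where
  open ≡-Reasoning
  a′ = Vec.map toℕ a

-- Induction on the number of variables: the first entry of `S` selects the restriction to follow.
-- With no variables left, the value is the sum of all coefficients, which is nonzero iff some
-- coefficient is.
≈₀₁⇒supports : (f g : Poly n) → f ≈₀₁ g → ∀ {S} → Supports S f → Supports S g
≈₀₁⇒supports {zero} f g f≈g {[]} supp =
  Any.map (λ { {c , []} c1≢0 → (λ { refl → c1≢0 refl }) , refl })
    (Any.map⁻ (sum≢0⁻ _ (subst (_≢ 0) (f≈g []) (sum≢0⁺ (Any.map⁺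
      (Any.map (λ { {c , []} (c≢0 , _) → c≢0 ∘ trans (sym (*-identityʳ c)) }) supp))))))
≈₀₁⇒supports {suc n} f g f≈g {outside ∷ S} supp = supports-outside⁻ g
  (≈₀₁⇒supports (restrict₀ f) (restrict₀ g) (≈₀₁-restrict₀ f g f≈g) (supports-outside⁺ f supp))
≈₀₁⇒supports {suc n} f g f≈g {inside ∷ S} supp = supports-inside⁻ g
  (≈₀₁⇒supports (restrict₁ f) (restrict₁ g) (≈₀₁-restrict₁ f g f≈g) (supports-inside⁺ f supp))

≈₀₁⇒⊑ : (f g : Poly n) → f ≈₀₁ g → f ⊑ g
≈₀₁⇒⊑ f g f≈g = sup⁺ g ∘ ≈₀₁⇒supports f g f≈g ∘ sup⁻ f

-- Elimination of the gates

prod : Poly n × Poly n → Poly n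
prod (g , h) = g *ₚ h

module Covering {n} (f : Poly n) {k l : ℕ} (1≤k : 1 ≤ k) (k≤l : k ≤ l) (free : Free k l f) where

  Large : Poly n → Set
  Large g = l < length (min g)

  -- Freeness bounds its first factor by `k` and its second by `l`, so it is applied with the weight
  -- `h` first; the alternative contradicts that `g` is large.
  large-weight : (g h : Poly n) → Large g → g *ₚ h ⊑ f → length (min h) ≤ k
  large-weight g h g-large gh⊑f with free h g (gh⊑f ∘ *-comm-⊑ h g)
  ... | inj₁ h≤k = h≤k
  ... | inj₂ g≤l = contradiction g≤l (<⇒≱ g-large)

  -- As `1 ≤ l`, the walk never has to continue at an input node.
  var-small : (i : Fin n) → ¬ Large (var i)
  var-small i large = <⇒≱ large (≤-trans (length-min-≤ (var i)) (≤-trans 1≤k k≤l))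

  -- The inclusion in `f` keeps the union of the products inside `sup f` and makes minimal sets of
  -- `f` stay minimal in every product containing them.
  Admissible : Poly n × Poly n → Set
  Admissible p = length (min (prod p)) ≤ k * l ^ 2 × prod p ⊑ f

  Covered : List (Poly n × Poly n) → Subset n → Set
  Covered ps S = Any (λ p → S ∈ sup (prod p)) ps

  -- A snapshot of all walks at once: `G` holds the gates still to be eliminated, `weight j`
  -- collects the weights of the walks waiting at gate `j` (`0ₚ` if there are none), and `b` bounds
  -- the charges made so far.
  record State (G : Gates n s) (b : ℕ) : Set where
    field
      pairs      : List (Poly n × Poly n)
      weight     : Fin s → Poly n
      bounded    : length pairs ≤ b
      admissible : All Admissible pairs
      valid      : ∀ j → polyAt G (inj₂ j) *ₚ weight j ⊑ f

  open State

  Reached : {G : Gates n s} {b : ℕ} → State G b → Subset n → Set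
  Reached {G = G} σ S = Covered (pairs σ) S ⊎
    (∃[ j ] Large (polyAt G (inj₂ j)) × S ∈ sup (polyAt G (inj₂ j) *ₚ weight σ j))

  -- The admissible products collected so far cover sup P, up to sets that
  -- still have to be traced below some large gate.
  record Reduction (G : Gates n s) (b : ℕ) (P : Poly n) : Set where
    constructor reduction
    field
      state : State G b
      reach : ∀ {S} → S ∈ sup P → Reached state S

  private
    variable
      G : Gates n s
      b b′ : ℕ
      P P₁ P₂ : Poly n

  weaken : b ≤ b′ → State G b → State G b′
  weaken b≤b′ σ = record { State σ ; bounded = ≤-trans (bounded σ) b≤b′ }

  mono : P₁ ⊑ P₂ → b ≤ b′ → Reduction G b P₂ → Reduction G b′ P₁
  mono P₁⊑P₂ b≤b′ (reduction σ reach) = reduction (weaken b≤b′ σ) (reach ∘ P₁⊑P₂)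

  -- Walks meeting at a gate merge by adding their weights; distributivity keeps the merged product
  -- inside `f`. Hence each gate is processed only once, and freeness applies to the summed weight.
  _⊞_ : State G b → State G b′ → State G (b + b′)
  _⊞_ {G = G} σ τ = record
    { pairs      = pairs σ ++ pairs τ
    ; weight     = λ j → weight σ j +ₚ weight τ j
    ; bounded    = ≤-trans (≤-reflexive (length-++ (pairs σ))) (+-mono-≤ (bounded σ) (bounded τ))
    ; admissible = All.++⁺ (admissible σ) (admissible τ)
    ; valid      = λ j S∈ → [ valid σ j , valid τ j ]′
        (*-distribˡ-⊑ (polyAt G (inj₂ j)) (weight σ j) (weight τ j) S∈)
    }

  reachedˡ : (σ : State G b) (τ : State G b′) {S : Subset n} → Reached σ S → Reached (σ ⊞ τ) S
  reachedˡ {G = G} σ τ = Sum.map Any.++⁺ˡ λ (j , large , S∈) → j , large ,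
    *-monoʳ-⊑ (polyAt G (inj₂ j)) (weight σ j) _ (∈-sup-+⁺ˡ (weight σ j) (weight τ j)) S∈

  reachedʳ : (σ : State G b) (τ : State G b′) {S : Subset n} → Reached τ S → Reached (σ ⊞ τ) S
  reachedʳ {G = G} σ τ = Sum.map (Any.++⁺ʳ (pairs σ)) λ (j , large , S∈) → j , large ,
    *-monoʳ-⊑ (polyAt G (inj₂ j)) (weight τ j) _ (∈-sup-+⁺ʳ (weight σ j) (weight τ j)) S∈

  union : Reduction G b P₁ → Reduction G b′ P₂ →
    (∀ {S} → S ∈ sup P → S ∈ sup P₁ ⊎ S ∈ sup P₂) → Reduction G (b + b′) P
  union (reduction σ reach₁) (reduction τ reach₂) split = reduction (σ ⊞ τ)
    λ S∈ → [ reachedˡ σ τ ∘ reach₁ , reachedʳ σ τ ∘ reach₂ ]′ (split S∈)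

  single : (g h : Poly n) → length (min (g *ₚ h)) ≤ k * l ^ 2 → g *ₚ h ⊑ f → Reduction G 1 (g *ₚ h)
  single {G = G} g h gh≤ gh⊑f = reduction record
    { pairs      = (g , h) ∷ []
    ; weight     = λ _ → 0ₚ
    ; bounded    = ≤-refl
    ; admissible = (gh≤ , gh⊑f) ∷ []
    ; valid      = λ j S∈ → contradiction S∈ (*-zeroʳ-∉ (polyAt G (inj₂ j)))
    } (inj₁ ∘ here)

  -- Moving to a large node costs no pair: the cofactor `h` is parked there as its weight.
  delegate : (u : Node n s) (h : Poly n) → Large (polyAt G u) → polyAt G u *ₚ h ⊑ f →
    Reduction G 0 (polyAt G u *ₚ h)
  delegate (inj₁ i) h large _ = contradiction large (var-small i)
  delegate {s = s} {G = G} (inj₂ j) h large jh⊑f = reduction record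
    { pairs      = []
    ; weight     = h-at-j
    ; bounded    = z≤n
    ; admissible = []
    ; valid      = valid-at
    } λ {S} S∈ → inj₂ (j , large ,
        subst (λ h → S ∈ sup (polyAt G (inj₂ j) *ₚ h)) (sym h-at-j-j) S∈)
    where
    h-at-j : Fin s → Poly n
    h-at-j i with i ≟ᶠ j
    ... | yes _ = h
    ... | no  _ = 0ₚ

    h-at-j-j : h-at-j j ≡ h
    h-at-j-j with j ≟ᶠ j
    ... | yes _   = refl
    ... | no  j≢j = contradiction refl j≢j

    valid-at : ∀ i → polyAt G (inj₂ i) *ₚ h-at-j i ⊑ f
    valid-at i S∈ with i ≟ᶠ j
    ... | yes refl = jh⊑f S∈
    ... | no  _    = contradiction S∈ (*-zeroʳ-∉ (polyAt G (inj₂ i)))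

  l*k≤kl² : l * k ≤ k * l ^ 2
  l*k≤kl² = begin
    l * k        ≡⟨ *-comm l k ⟩
    k * l        ≡⟨ cong (k *_) (^-identityʳ l) ⟨
    k * l ^ 1    ≤⟨ *-monoʳ-≤ k (^-monoʳ-≤ l {{>-nonZero (≤-trans 1≤k k≤l)}} {1} {2} (s≤s z≤n)) ⟩
    k * l ^ 2    ∎
    where open ≤-Reasoning

  small-*-≤ : (g h : Poly n) → ¬ Large g → length (min h) ≤ k → length (min (g *ₚ h)) ≤ k * l ^ 2
  small-*-≤ g h g-small h≤k = ≤-trans (length-min-* g h)
    (≤-trans (*-mono-≤ (≮⇒≥ g-small) h≤k) l*k≤kl²)

  push : (u : Node n s) (h : Poly n) → length (min h) ≤ k → polyAt G u *ₚ h ⊑ f →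
    Reduction G 1 (polyAt G u *ₚ h)
  push {G = G} u h h≤k uh⊑f with l <? length (min (polyAt G u))
  ... | yes large = mono id z≤n (delegate u h large uh⊑f)
  ... | no  small = single (polyAt G u) h (small-*-≤ (polyAt G u) h small h≤k) uh⊑f

  -- An addition gate is charged at most once per child, a multiplication gate at most once
  -- altogether; hence the 2.
  reduceGate : (γ : Gate n s) (h : Poly n) → length (min h) ≤ k → gatePoly G γ *ₚ h ⊑ f →
    Reduction G 2 (gatePoly G γ *ₚ h)
  reduceGate {G = G} (u ⊕ v) h h≤k γh⊑f =
    union
      (push u h h≤k (γh⊑f ∘ *-monoˡ-⊑ g₁ (g₁ +ₚ g₂) h (∈-sup-+⁺ˡ g₁ g₂)))
      (push v h h≤k (γh⊑f ∘ *-monoˡ-⊑ g₂ (g₁ +ₚ g₂) h (∈-sup-+⁺ʳ g₁ g₂)))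
      (*-distribʳ-⊑ g₁ g₂ h)
    where
    g₁ = polyAt G u
    g₂ = polyAt G v
  reduceGate {G = G} (u ⊗ v) h h≤k γh⊑f = byCases
    where
    open ≤-Reasoning
    g₁ = polyAt G u
    g₂ = polyAt G v

    swap-⊑ : g₂ *ₚ g₁ *ₚ h ⊑ g₁ *ₚ g₂ *ₚ h
    swap-⊑ = *-monoˡ-⊑ (g₂ *ₚ g₁) (g₁ *ₚ g₂) h (*-comm-⊑ g₂ g₁)

    byCases : Reduction G 2 (g₁ *ₚ g₂ *ₚ h)
    -- A large factor is followed and the other factor joins the weight. The new weight needs no
    -- bound yet: `large-weight` supplies one when the walk leaves the gate it moves to.
    byCases with l <? length (min g₁) | l <? length (min g₂)
    ... | yes large | _ = mono (*-assoc-⊑ g₁ g₂ h) z≤n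
      (delegate u (g₂ *ₚ h) large (γh⊑f ∘ *-assoc-⊒ g₁ g₂ h))
    ... | no _ | yes large = mono
      (*-assoc-⊑ g₂ g₁ h ∘ *-monoˡ-⊑ (g₁ *ₚ g₂) (g₂ *ₚ g₁) h (*-comm-⊑ g₁ g₂)) z≤n
      (delegate v (g₁ *ₚ h) large (γh⊑f ∘ swap-⊑ ∘ *-assoc-⊒ g₂ g₁ h))
    ... | no small₁ | no small₂ = mono id (s≤s z≤n) (single (g₁ *ₚ g₂) h (begin
      length (min (g₁ *ₚ g₂ *ₚ h))                              ≤⟨ length-min-* (g₁ *ₚ g₂) h ⟩
      length (min (g₁ *ₚ g₂)) * length (min h)                  ≤⟨ *-monoˡ-≤ _ (length-min-* g₁ g₂) ⟩
      length (min g₁) * length (min g₂) * length (min h)        ≤⟨ *-mono-≤ (*-mono-≤ (≮⇒≥ small₁) (≮⇒≥ small₂)) h≤k ⟩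
      l * l * k                                                 ≡⟨ *-comm (l * l) k ⟩
      k * (l * l)                                               ≡⟨ cong (λ x → k * (l * x)) (*-identityʳ l) ⟨
      k * l ^ 2                                                 ∎) γh⊑f)

  -- The newest gate is read by no remaining gate, so every walk that can arrive at it has arrived
  -- and its weight is final.
  dropGate : {γ : Gate n s} → Reduction (G ▷ γ) b P → Reduction G (b + 2) P
  dropGate {G = G} {b = b} {P = P} {γ = γ} (reduction σ reach) = byCases
    where
    rest : State G b
    rest = record { State σ ; weight = weight σ ∘ suc ; valid = valid σ ∘ suc }

    byCases : Reduction G (b + 2) P
    byCases with l <? length (min (gatePoly G γ))
    -- Only large gates have sets waiting in `Reached`, so a small gate is discarded without charge
    -- and without loss.
    ... | no small = reduction (weaken (m≤m+n b 2) rest) λ S∈ → Sum.map₂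
      (λ { (zero , large , _) → contradiction large small
         ; (suc j , reached-j) → j , reached-j }) (reach S∈)
    ... | yes large
      with reduction τ reach-γ ← reduceGate γ (weight σ zero)
             (large-weight (gatePoly G γ) (weight σ zero) large (valid σ zero)) (valid σ zero)
      = reduction (rest ⊞ τ) λ S∈ → [ reachedˡ rest τ ∘ inj₁
        , (λ { (zero  , _ , S∈γ)   → reachedʳ rest τ (reach-γ S∈γ)
             ; (suc j , reached-j) → reachedˡ rest τ (inj₂ (j , reached-j)) }) ]′ (reach S∈)

  dropAll : (G : Gates n s) → Reduction G b P → Reduction [] (b + s * 2) P
  dropAll [] r = mono id (m≤m+n _ 0) r
  dropAll {b = b} (_▷_ {s = s} G γ) r =
    mono id (≤-reflexive (+-assoc b 2 (s * 2))) (dropAll G (dropGate r))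

  cover : (C : Circuit n) → produced C ⊑ f →
    Σ[ ps ∈ List (Poly n × Poly n) ] (length ps ≤ 2 * size C × All Admissible ps ×
      (∀ {S} → S ∈ sup (produced C) → Covered ps S))
  cover C F⊑f with l <? length (min (produced C))
  ... | no small = (F , 1ₚ) ∷ []
      -- The index `output C` witnesses that the size is at least 1, so one pair fits the bound.
      , *-mono-≤ {1} {2} (s≤s z≤n) (≤-<-trans z≤n (toℕ<n (output C)))
      , (small-*-≤ F 1ₚ small (≤-trans (length-min-≤ {n} 1ₚ) 1≤k) , F⊑f ∘ *-identityʳ-⊑ F) ∷ []
      , here ∘ *-identityʳ-⊒ F
    where F = produced C
  ... | yes large
    -- The walk starts at the output with weight `1ₚ` and nothing charged; each gate then adds 2.
    with reduction σ reach ← dropAll (gates C)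
           (delegate (inj₂ (output C)) 1ₚ large (F⊑f ∘ *-identityʳ-⊑ (produced C)))
    = pairs σ , ≤-trans (bounded σ) (≤-reflexive (*-comm (size C) 2)) , admissible σ
    -- No gates remain, so no set is still waiting and all are covered.
    , λ S∈ → [ id , (λ { (() , _) }) ]′ (reach (*-identityʳ-⊒ (produced C) S∈))

-- From the cover to the bound on the circuit size

ℚᵘ-≥ : {c m d : ℕ} .{{_ : NonZero d}} → m ≤ c * d → (+ c / 1) ≥ (+ m / d)
ℚᵘ-≥ {c} {m} {suc d} m≤cd = *≤* (subst₂ ℤ._≤_ (ℤ.pos-* m 1) (ℤ.pos-* c (suc d))
  (+≤+ (≤-trans (≤-reflexive (*-identityʳ m)) m≤cd)))

theorem9 : (k l : ℕ) (1≤k : 1 ≤ k) (k≤l : k ≤ l)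
    (n : ℕ) (f : Poly n) → Free k l f → (c : ℕ) → IsC₀₁ f c →
    (Σ[ ps ∈ List (Poly n × Poly n) ]
    (length ps ≤ 2 * c
    × All (λ p → length (min (proj₁ p *ₚ proj₂ p)) ≤ k * l ^ 2) ps
    × ((S : Subset n) → S ∈ sup f ⇔ Any (λ p → S ∈ sup (proj₁ p *ₚ proj₂ p)) ps)))
    × (+ c / 1) ≥ (+ length (min f) / (2 * (k * l ^ 2))) {{2kl²≢0 1≤k k≤l}}
theorem9 k l 1≤k k≤l n f free c is-c with C , counts , refl ← IsC₀₁.attained is-c
  -- Equality of values is used both ways: here `produced C ⊑ f` keeps the products inside `f`, and
  -- in `f⊆ps` the reverse inclusion makes them cover `sup f`.
  with ps , ps≤ , adm , covers ← Covering.cover f 1≤k k≤l free C (≈₀₁⇒⊑ (produced C) f counts)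
  = (ps , ps≤ , All.map proj₁ adm , λ S → mk⇔ f⊆ps ps⊆f)
  , ℚᵘ-≥ {{2kl²≢0 1≤k k≤l}} (begin
      length (min f)                           ≤⟨ unique-⊆⇒length-≤ _≟ₛ_ (min! f) min⊆ ⟩
      length (concatMap (min ∘ prod) ps)       ≤⟨ length-concatMap-≤ (min ∘ prod) (All.map proj₁ adm) ⟩
      length ps * (k * l ^ 2)                  ≤⟨ *-monoˡ-≤ (k * l ^ 2) ps≤ ⟩
      2 * c * (k * l ^ 2)                      ≡⟨ cong (_* (k * l ^ 2)) (*-comm 2 c) ⟩
      c * 2 * (k * l ^ 2)                      ≡⟨ *-assoc c 2 (k * l ^ 2) ⟩
      c * (2 * (k * l ^ 2))                    ∎)
  where
  open ≤-Reasoning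

  f⊆ps : ∀ {S} → S ∈ sup f → Any (λ p → S ∈ sup (prod p)) ps
  f⊆ps = covers ∘ ≈₀₁⇒⊑ f (produced C) (sym ∘ counts)

  ps⊆f : ∀ {S} → Any (λ p → S ∈ sup (prod p)) ps → S ∈ sup f
  ps⊆f any with _ , p∈ps , S∈p ← find any = proj₂ (All.lookup adm p∈ps) S∈p

  -- A minimal set of `f` lies in some product, and stays minimal there because the support of the
  -- product is part of `sup f`.
  min⊆ : ∀ {S} → S ∈ min f → S ∈ concatMap (min ∘ prod) ps
  min⊆ S∈min
    with S∈f , S-min ← ∈-min⁻ f S∈min
    with p , p∈ps , S∈p ← find (f⊆ps S∈f)
    = ∈-concatMap⁺ (min ∘ prod) (lose p∈ps (∈-min⁺ (prod p) S∈p
        (All.tabulate λ T∈p → All.lookup S-min (proj₂ (All.lookup adm p∈ps) T∈p))))
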